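{- Let $\mathcal{O}_K$ be a Dedekind domain and let $\mathfrak{n}$ be a composite ideal of $\mathcal{O}_K$. Then $\mathfrak{n}$ is a Carmichael ideal of $\mathcal{O}_K$ if and only if all of the following hold: (1) $\mathfrak{n}$ is square-free; (2) $N_K(\mathfrak{n})$ is finite; (3) $N_K(\mathfrak{p})-1$ divides $N_K(\mathfrak{n})-1$ for every prime ideal $\mathfrak{p}$ dividing $\mathfrak{n}$.
   Context: For an ideal $\mathfrak{n}$ of $\mathcal{O}_K$, $N_K(\mathfrak{n})=|\mathcal{O}_K/\mathfrak{n}|$. A composite ideal means a nonzero proper ideal that is not a prime ideal. A finite ring $S$ is a Carmichael ring if $S$ is not a field and $a^{|S|}=a$ for every $a\in S$; an ideal $I$ of a ring $R$ is a Carmichael ideal if $R/I$ is a Carmichael ring. Square-free means that in the prime ideal factorization of $\mathfrak{n}$ every exponent equals $1$. -}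

module Defs where

open import Level using (Level; _⊔_) renaming (suc to lsuc)
open import Algebra.Bundles using (CommutativeRing)
open import Data.Fin.Base using (Fin)
open import Data.List.Base using (List; []; _∷_; foldl)
open import Data.List.Relation.Unary.All using (All)
open import Data.List.Relation.Unary.AllPairs using (AllPairs)
open import Data.Nat.Base as ℕ using (ℕ; zero; suc)
open import Data.Product.Base using (Σ; ∃; _×_; _,_; proj₁; proj₂)
open import Data.Sum.Base using (_⊎_; [_,_])
open import Function.Bundles using (Inverse)
open import Relation.Binary.Bundles using (Setoid)
open import Relation.Binary.PropositionalEquality.Core using (_≡_)
open import Relation.Binary.PropositionalEquality.Properties using (setoid)
open import Relation.Nullary.Negation.Core using (¬_)
open import Relation.Unary using (Pred) renaming (_≐_ to _≐ᵖ_; _⊆_ to _⊆ᵖ_)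

import Algebra.Properties.AbelianGroup as AbelianGroupProps
import Algebra.Properties.CommutativeSemigroup as CommSemigroupProps
import Algebra.Properties.Ring as RingProps
import Algebra.Properties.Semiring.Exp as SemiringExp
import Relation.Binary.Reasoning.Setoid as SetoidReasoning

private
  variable
    c ℓ : Level

Finite : Setoid c ℓ → Set (c ⊔ ℓ)
Finite S = ∃ λ n → Inverse S (setoid (Fin n))

card : {S : Setoid c ℓ} → Finite S → ℕ
card = proj₁

record IsField (S : CommutativeRing c ℓ) : Set (c ⊔ ℓ) where
  open CommutativeRing S
  field
    1≉0     : ¬ (1# ≈ 0#)
    inverse : ∀ x → ¬ (x ≈ 0#) → ∃ λ y → x * y ≈ 1#

record IsCarmichaelRing (S : CommutativeRing c ℓ) : Set (c ⊔ ℓ) where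
  open CommutativeRing S using (Carrier; _≈_; semiring) renaming (setoid to setoidˢ)
  open SemiringExp semiring using (_^_)
  field
    finite   : Finite setoidˢ
    notField : ¬ IsField S
    power    : ∀ (a : Carrier) → a ^ card finite ≈ a

module _ (R : CommutativeRing c ℓ) where
  open CommutativeRing R

  -- The level c ⊔ ℓ is the least one at which ideals are closed under
  -- products.
  record Ideal : Set (lsuc (c ⊔ ℓ)) where
    field
      member   : Pred Carrier (c ⊔ ℓ)
      resp     : ∀ {x y} → x ≈ y → member x → member y
      0∈       : member 0#
      +-closed : ∀ {x y} → member x → member y → member (x + y)
      absorb   : ∀ r {x} → member x → member (r * x)

module _ {R : CommutativeRing c ℓ} where
  open CommutativeRing R
  open AbelianGroupProps +-abelianGroup using (⁻¹-∙-comm; ⁻¹-involutive)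
  open RingProps ring using (-1*x≈-x; -‿distribʳ-*)

  infix 4 _∈_ _⊆_ _⊂_ _≐_ _∣ᴵ_
  infixl 7 _·_

  _∈_ : Carrier → Ideal R → Set (c ⊔ ℓ)
  x ∈ I = Ideal.member I x

  _⊆_ _⊂_ _≐_ : Ideal R → Ideal R → Set (c ⊔ ℓ)
  I ⊆ J = Ideal.member I ⊆ᵖ Ideal.member J
  I ⊂ J = I ⊆ J × ¬ (J ⊆ I)
  I ≐ J = Ideal.member I ≐ᵖ Ideal.member J

  record UnitMember (x : Carrier) : Set (c ⊔ ℓ) where
    constructor unit

  unitIdeal : Ideal R
  unitIdeal = record
    { member   = UnitMember
    ; resp     = λ _ _ → unit
    ; 0∈       = unit
    ; +-closed = λ _ _ → unit
    ; absorb   = λ _ _ → unit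
    }

  -- Finite sums of products a * b with a ∈ I and b ∈ J.
  data ProductMember (I J : Ideal R) (x : Carrier) : Set (c ⊔ ℓ) where
    none : x ≈ 0# → ProductMember I J x
    more : ∀ {a b y} → a ∈ I → b ∈ J → ProductMember I J y →
           x ≈ a * b + y → ProductMember I J x

  _·_ : Ideal R → Ideal R → Ideal R
  I · J = record
    { member   = ProductMember I J
    ; resp     = resp′
    ; 0∈       = none refl
    ; +-closed = +-closed′
    ; absorb   = absorb′
    }
    where
    resp′ : ∀ {x y} → x ≈ y → ProductMember I J x → ProductMember I J y
    resp′ x≈y (none x≈0)       = none (trans (sym x≈y) x≈0)
    resp′ x≈y (more a b z eq) = more a b z (trans (sym x≈y) eq)

    +-closed′ : ∀ {x y} → ProductMember I J x → ProductMember I J y →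
                ProductMember I J (x + y)
    +-closed′ (none x≈0) q =
      resp′ (sym (trans (+-congʳ x≈0) (+-identityˡ _))) q
    +-closed′ (more a b z eq) q =
      more a b (+-closed′ z q) (trans (+-congʳ eq) (+-assoc _ _ _))

    absorb′ : ∀ r {x} → ProductMember I J x → ProductMember I J (r * x)
    absorb′ r (none x≈0) = none (trans (*-congˡ x≈0) (zeroʳ r))
    absorb′ r (more a b z eq) =
      more (Ideal.absorb I r a) b (absorb′ r z)
        (trans (*-congˡ eq)
          (trans (distribˡ r _ _) (+-congʳ (sym (*-assoc r _ _)))))

  _^ᴵ_ : Ideal R → ℕ → Ideal R
  I ^ᴵ zero  = unitIdeal
  I ^ᴵ suc e = I · (I ^ᴵ e)

  _∣ᴵ_ : Ideal R → Ideal R → Set (lsuc (c ⊔ ℓ))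
  I ∣ᴵ J = ∃ λ K → J ≐ I · K

  IsProper : Ideal R → Set (c ⊔ ℓ)
  IsProper I = ¬ (1# ∈ I)

  IsNonzero : Ideal R → Set (c ⊔ ℓ)
  IsNonzero I = ∃ λ x → x ∈ I × ¬ (x ≈ 0#)

  record IsPrime (P : Ideal R) : Set (c ⊔ ℓ) where
    field
      proper : IsProper P
      split  : ∀ x y → x * y ∈ P → x ∈ P ⊎ y ∈ P

  record IsMaximal (P : Ideal R) : Set (lsuc (c ⊔ ℓ)) where
    field
      proper  : IsProper P
      maximal : ∀ J → IsProper J → P ⊆ J → J ⊆ P

  record IsComposite (I : Ideal R) : Set (c ⊔ ℓ) where
    field
      nonzero  : IsNonzero I
      proper   : IsProper I
      notPrime : ¬ IsPrime I

  quotient : Ideal R → CommutativeRing c (c ⊔ ℓ)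
  quotient I = record
    { Carrier = Carrier
    ; _≈_     = _~_
    ; _+_     = _+_
    ; _*_     = _*_
    ; -_      = -_
    ; 0#      = 0#
    ; 1#      = 1#
    ; isCommutativeRing = record
      { isRing = record
        { +-isAbelianGroup = record
          { isGroup = record
            { isMonoid = record
              { isSemigroup = record
                { isMagma = record
                  { isEquivalence = record
                    { refl = lift refl ; sym = ~-sym ; trans = ~-trans }
                  ; ∙-cong = +-cong~
                  }
                ; assoc = λ x y z → lift (+-assoc x y z)
                }
              ; identity = (λ x → lift (+-identityˡ x)) , (λ x → lift (+-identityʳ x))
              }
            ; inverse = (λ x → lift (-‿inverseˡ x)) , (λ x → lift (-‿inverseʳ x))
            ; ⁻¹-cong = -‿cong~
            }
          ; comm = λ x y → lift (+-comm x y)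
          }
        ; *-cong     = *-cong~
        ; *-assoc    = λ x y z → lift (*-assoc x y z)
        ; *-identity = (λ x → lift (*-identityˡ x)) , (λ x → lift (*-identityʳ x))
        ; distrib    = (λ x y z → lift (distribˡ x y z)) , (λ x y z → lift (distribʳ x y z))
        }
      ; *-comm = λ x y → lift (*-comm x y)
      }
    }
    where
    open Ideal I using (resp; 0∈; +-closed; absorb)
    open SetoidReasoning (CommutativeRing.setoid R)

    _~_ : Carrier → Carrier → Set (c ⊔ ℓ)
    x ~ y = (x - y) ∈ I

    lift : ∀ {x y} → x ≈ y → x ~ y
    lift {x} {y} x≈y = resp (sym (trans (+-congʳ x≈y) (-‿inverseʳ y))) 0∈

    neg : ∀ {x} → x ∈ I → (- x) ∈ I
    neg {x} x∈ = resp (-1*x≈-x x) (absorb (- 1#) x∈)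

    -[x-y] : ∀ x y → - (x - y) ≈ - x - (- y)
    -[x-y] x y = sym (⁻¹-∙-comm x (- y))

    ~-sym : ∀ {x y} → x ~ y → y ~ x
    ~-sym {x} {y} p = resp eq (neg p)
      where
      eq : - (x - y) ≈ y - x
      eq = begin
        - (x - y)    ≈⟨ -[x-y] x y ⟩
        - x - (- y)  ≈⟨ +-congˡ (⁻¹-involutive y) ⟩
        - x + y      ≈⟨ +-comm (- x) y ⟩
        y - x        ∎

    telescope : ∀ x y z → (x - y) + (y - z) ≈ x - z
    telescope x y z = begin
      (x - y) + (y - z)      ≈⟨ +-assoc x (- y) (y - z) ⟩
      x + (- y + (y - z))    ≈⟨ +-congˡ (+-assoc (- y) y (- z)) ⟨
      x + ((- y + y) - z)    ≈⟨ +-congˡ (+-congʳ (-‿inverseˡ y)) ⟩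
      x + (0# - z)           ≈⟨ +-congˡ (+-identityˡ (- z)) ⟩
      x - z                  ∎

    ~-trans : ∀ {x y z} → x ~ y → y ~ z → x ~ z
    ~-trans {x} {y} {z} p q = resp (telescope x y z) (+-closed p q)

    +-cong~ : ∀ {x y u v} → x ~ y → u ~ v → (x + u) ~ (y + v)
    +-cong~ {x} {y} {u} {v} p q = resp eq (+-closed p q)
      where
      open CommSemigroupProps (CommutativeRing.+-commutativeSemigroup R)
        using (interchange)
      eq : (x - y) + (u - v) ≈ (x + u) - (y + v)
      eq = trans (interchange x (- y) u (- v)) (+-congˡ (⁻¹-∙-comm y v))

    -‿cong~ : ∀ {x y} → x ~ y → (- x) ~ (- y)
    -‿cong~ {x} {y} p = resp (-[x-y] x y) (neg p)

    *-congˡ~ : ∀ r {x y} → x ~ y → (r * x) ~ (r * y)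
    *-congˡ~ r {x} {y} p = resp eq (absorb r p)
      where
      eq : r * (x - y) ≈ r * x - r * y
      eq = trans (distribˡ r x (- y)) (+-congˡ (sym (-‿distribʳ-* r y)))

    *-cong~ : ∀ {x y u v} → x ~ y → u ~ v → (x * u) ~ (y * v)
    *-cong~ {x} {y} {u} {v} p q =
      ~-trans (*-congˡ~ x q)
        (~-trans (lift (*-comm x v))
          (~-trans (*-congˡ~ v p) (lift (*-comm v y))))

  FiniteNorm : Ideal R → Set (c ⊔ ℓ)
  FiniteNorm I = Finite (CommutativeRing.setoid (quotient I))

  norm : (I : Ideal R) → FiniteNorm I → ℕ
  norm I = card

  IsCarmichaelIdeal : Ideal R → Set (c ⊔ ℓ)
  IsCarmichaelIdeal I = IsCarmichaelRing (quotient I)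

  primePowers : List (Ideal R × ℕ) → Ideal R
  primePowers []             = unitIdeal
  primePowers ((P , e) ∷ fs) = (P ^ᴵ e) · primePowers fs

  record PrimeFactorisation (I : Ideal R) : Set (lsuc (c ⊔ ℓ)) where
    field
      factors   : List (Ideal R × ℕ)
      prime     : All (λ f → IsPrime (proj₁ f)) factors
      positive  : All (λ f → 0 ℕ.< proj₂ f) factors
      distinct  : AllPairs (λ f g → ¬ (proj₁ f ≐ proj₁ g)) factors
      factorise : I ≐ primePowers factors

  -- In a Dedekind domain the factorisation of a nonzero ideal is unique up
  -- to order, so it does not matter which one is inspected.
  IsSquareFree : Ideal R → Set (lsuc (c ⊔ ℓ))
  IsSquareFree I = Σ (PrimeFactorisation I) λ F →
    All (λ f → proj₂ f ≡ 1) (PrimeFactorisation.factors F)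

record IsIntegralDomain (R : CommutativeRing c ℓ) : Set (c ⊔ ℓ) where
  open CommutativeRing R
  field
    1≉0            : ¬ (1# ≈ 0#)
    noZeroDivisors : ∀ x y → x * y ≈ 0# → x ≈ 0# ⊎ y ≈ 0#

module FractionField {R : CommutativeRing c ℓ} (domain : IsIntegralDomain R) where
  open CommutativeRing R
  open IsIntegralDomain domain

  record Fraction : Set (c ⊔ ℓ) where
    constructor _/_[_]
    field
      num   : Carrier
      den   : Carrier
      den≉0 : ¬ (den ≈ 0#)

  infix  4 _≈ᶠ_
  infixl 6 _+ᶠ_
  infixl 7 _*ᶠ_

  _≈ᶠ_ : Fraction → Fraction → Set ℓ
  (a / b [ _ ]) ≈ᶠ (a′ / b′ [ _ ]) = a * b′ ≈ a′ * b

  private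
    nonzero-* : ∀ {x y} → ¬ (x ≈ 0#) → ¬ (y ≈ 0#) → ¬ (x * y ≈ 0#)
    nonzero-* x≉0 y≉0 xy≈0 = [ x≉0 , y≉0 ] (noZeroDivisors _ _ xy≈0)

  _+ᶠ_ _*ᶠ_ : Fraction → Fraction → Fraction
  (a / b [ p ]) +ᶠ (a′ / b′ [ q ]) = (a * b′ + a′ * b) / (b * b′) [ nonzero-* p q ]
  (a / b [ p ]) *ᶠ (a′ / b′ [ q ]) = (a * a′) / (b * b′) [ nonzero-* p q ]

  embed : Carrier → Fraction
  embed r = r / 1# [ 1≉0 ]

  -- The monic polynomial Xⁿ + c₁ Xⁿ⁻¹ + ⋯ + cₙ with coefficient list
  -- c₁ ∷ ⋯ ∷ cₙ ∷ [], evaluated by Horner's rule.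
  monic : List Carrier → Fraction → Fraction
  monic cs x = foldl (λ acc r → (acc *ᶠ x) +ᶠ embed r) (embed 1#) cs

  IsIntegral : Fraction → Set (c ⊔ ℓ)
  IsIntegral x = ∃ λ cs → monic cs x ≈ᶠ embed 0#

-- Ascending chain condition, stated negatively so that it does not by
-- itself entail instances of excluded middle (as "every ideal is finitely
-- generated" does, constructively).
IsNoetherian : CommutativeRing c ℓ → Set (lsuc (c ⊔ ℓ))
IsNoetherian R = ¬ (∃ λ (I : ℕ → Ideal R) → ∀ k → I k ⊂ I (suc k))

-- Fields are allowed; they have no composite ideals.
record IsDedekindDomain (R : CommutativeRing c ℓ) : Set (lsuc (c ⊔ ℓ)) where
  field
    isIntegralDomain : IsIntegralDomain R
    noetherian       : IsNoetherian R
    nonzeroPrime⇒maximal : ∀ (P : Ideal R) → IsPrime P → IsNonzero P → IsMaximal P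

  open FractionField isIntegralDomain

  field
    integrallyClosed : ∀ x → IsIntegral x → ∃ λ r → x ≈ᶠ embed r

{-# OPTIONS --safe #-}

-- If a^N ≡ a modulo 𝔫 for all a, then each a is von Neumann regular modulo 𝔫:
-- a b and 1 − a b are complementary idempotents for b = a^(N−2).  Splitting 𝔫
-- into the colon ideals 𝔫 : a b and 𝔫 : (1 − a b), for one representative a
-- after the other, ends with pairwise comaximal ideals modulo which every
-- element is zero or a unit; these are primes, and their product is their
-- intersection 𝔫.  Conversely, distinct primes of finite norm are comaximal, so
-- a^N ≡ a may be checked modulo each prime 𝔭 dividing 𝔫.  Finally, in the finite
-- field O/𝔭 with Q elements, x^k = 1 for all x ≠ 0 if and only if Q − 1 ∣ k, by
-- Fermat's theorem and because X^(k mod (Q−1)) − 1 has at most k mod (Q−1) roots.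
module Submission where

open import Defs
open import Level using (Level; _⊔_) renaming (suc to lsuc)
open import Algebra.Bundles using (CommutativeRing)
open import Data.Empty using (⊥-elim)
open import Data.Fin.Base using (Fin; zero; suc; toℕ; punchIn; punchOut)
import Data.Fin.Permutation as Perm
import Data.Fin.Properties as Finₚ
open import Data.List.Base using (List; []; _∷_; _++_; length; map; replicate; tabulate)
open import Data.List.Properties using (length-replicate)
open import Data.List.Relation.Unary.All as All using (All; []; _∷_)
import Data.List.Relation.Unary.All.Properties as Allₚ
open import Data.List.Relation.Unary.AllPairs using (AllPairs; []; _∷_)
import Data.List.Relation.Unary.AllPairs.Properties as AllPairsₚ
open import Data.Nat as ℕ using (ℕ; zero; suc; _∸_; _%_; s≤s; z≤n)
open import Data.Nat.Divisibility using (_∣_; divides; m%n≡0⇒n∣m)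
open import Data.Nat.DivMod using (m≡m%n+[m/n]*n; m%n<n)
import Data.Nat.Properties as ℕₚ
open import Data.Product using (∃; Σ; _×_; _,_; proj₁; proj₂)
open import Data.Sum using (_⊎_; inj₁; inj₂; [_,_]′) renaming (map to ⊎-map)
open import Function using (_∘_; Injection; Inverse; mk⇔)
open import Function.Bundles using (_⇔_)
open import Function.Properties.Inverse using (Inverse⇒Injection)
open import Relation.Binary.Bundles using (Setoid)
open import Relation.Binary.Definitions using (Decidable)
open import Relation.Binary.PropositionalEquality as ≡ using (_≡_)
open import Relation.Nullary using (¬_; Dec; yes; no; contradiction)
open import Relation.Nullary.Decidable using (map′; via-injection; _×-dec_; ¬?)

import Algebra.Properties.CommutativeMonoid.Sum as CommutativeMonoidSum
import Algebra.Properties.CommutativeSemigroup as CommutativeSemigroupProps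
import Algebra.Properties.CommutativeSemiring.Exp as CommutativeSemiringExp
import Algebra.Properties.Group as GroupProps
import Algebra.Properties.Ring as RingProps
import Algebra.Solver.Ring.NaturalCoefficients.Default as SemiringSolver
import Relation.Binary.Reasoning.Setoid as SetoidReasoning

private
  variable
    c ℓ : Level

-- Finite setoids.

finite⇒decidable : (S : Setoid c ℓ) → Finite S → Decidable (Setoid._≈_ S)
finite⇒decidable S (n , inv) = via-injection (Inverse⇒Injection inv) Finₚ._≟_

-- Applied to `1#` and `0#` in a proper quotient, this gives `2 ≤ N` and hence the exponent `N − 2`.
≉⇒1<card : (S : Setoid c ℓ) (fin : Finite S) → let open Setoid S in
            ∀ {x y} → ¬ (x ≈ y) → 1 ℕ.< card fin
≉⇒1<card S (zero        , inv) {x} x≉y with () ← Inverse.to inv x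
≉⇒1<card S (suc zero    , inv) x≉y =
  contradiction (Injection.injective (Inverse⇒Injection inv) (Fin1-unique _ _)) x≉y
  where
  Fin1-unique : (i j : Fin 1) → i ≡ j
  Fin1-unique zero zero = ≡.refl
≉⇒1<card S (suc (suc _) , inv) x≉y = s≤s (s≤s z≤n)

-- Roots of polynomials and unit groups of finite integral domains.

module Domain (S : CommutativeRing c ℓ) (isIntegralDomain : IsIntegralDomain S) where
  open CommutativeRing S hiding (zero)
  open IsIntegralDomain isIntegralDomain
  open CommutativeSemiringExp commutativeSemiring using (_^_; ^-homo-*; ^-assocʳ; ^-congʳ)
  open RingProps ring using (-‿distribʳ-*; -‿distribˡ-*)
  open GroupProps +-group using (x∙y⁻¹≈ε⇒x≈y)
  open SetoidReasoning setoid

  *-cancelˡ : ∀ {x} y z → ¬ (x ≈ 0#) → x * y ≈ x * z → y ≈ z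
  *-cancelˡ {x} y z x≉0 xy≈xz with noZeroDivisors x (y - z) eq
    where
    eq : x * (y - z) ≈ 0#
    eq = begin
      x * (y - z)      ≈⟨ distribˡ x y (- z) ⟩
      x * y + x * - z  ≈⟨ +-cong xy≈xz (sym (-‿distribʳ-* x z)) ⟩
      x * z - x * z    ≈⟨ -‿inverseʳ (x * z) ⟩
      0#               ∎
  ... | inj₁ x≈0   = contradiction x≈0 x≉0
  ... | inj₂ y-z≈0 = x∙y⁻¹≈ε⇒x≈y y z y-z≈0

  *-nonzero : ∀ {x y} → ¬ (x ≈ 0#) → ¬ (y ≈ 0#) → ¬ (x * y ≈ 0#)
  *-nonzero x≉0 y≉0 xy≈0 = [ x≉0 , y≉0 ]′ (noZeroDivisors _ _ xy≈0)

  ^-nonzero : ∀ {x} k → ¬ (x ≈ 0#) → ¬ (x ^ k ≈ 0#)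
  ^-nonzero zero    x≉0 = 1≉0
  ^-nonzero (suc k) x≉0 = *-nonzero x≉0 (^-nonzero k x≉0)

  -- The value at x of the monic polynomial c₀ + c₁ X + ⋯ + c₍d₋₁₎ Xᵈ⁻¹ + Xᵈ.
  monicAt : List Carrier → Carrier → Carrier
  monicAt []       x = 1#
  monicAt (c ∷ cs) x = c + x * monicAt cs x

  -- Synthetic division: the coefficients of (P(X) - P(a)) / (X - a) for P given by `c ∷ cs`. If P =
  -- c + X p and q is the quotient for p, then the quotient for P is p(a) + X q.
  deflate : Carrier → Carrier → List Carrier → List Carrier
  deflate a c []        = []
  deflate a c (c′ ∷ cs) = monicAt (c′ ∷ cs) a ∷ deflate a c′ cs

  length-deflate : ∀ a c cs → length (deflate a c cs) ≡ length cs
  length-deflate a c []        = ≡.refl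
  length-deflate a c (c′ ∷ cs) = ≡.cong suc (length-deflate a c′ cs)

  -- P(x) − P(a) = (x − a) Q(x), with both sides moved so that no
  -- subtraction occurs.
  deflate-correct : ∀ a c cs x →
    let q = monicAt (deflate a c cs) x in
    monicAt (c ∷ cs) x + a * q ≈ monicAt (c ∷ cs) a + x * q
  deflate-correct a c [] x =
    solve 3 (λ a c x → (c :+ x :* con 1) :+ a :* con 1 := (c :+ a :* con 1) :+ x :* con 1)
      refl a c x
    where open SemiringSolver commutativeSemiring
  deflate-correct a c (c′ ∷ cs) x = begin
    (c + x * p) + a * (pₐ + x * q)  ≈⟨ solve 6 (λ a c x p pₐ q →
        (c :+ x :* p) :+ a :* (pₐ :+ x :* q) := (c :+ a :* pₐ) :+ x :* (p :+ a :* q))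
        refl a c x p pₐ q ⟩
    (c + a * pₐ) + x * (p + a * q)  ≈⟨ +-congˡ (*-congˡ (deflate-correct a c′ cs x)) ⟩
    (c + a * pₐ) + x * (pₐ + x * q) ∎
    where
    open SemiringSolver commutativeSemiring
    p pₐ q : Carrier
    p  = monicAt (c′ ∷ cs) x
    pₐ = monicAt (c′ ∷ cs) a
    q  = monicAt (deflate a c′ cs) x

  -- Induction on the degree: dividing out the first root leaves a polynomial that vanishes at all
  -- the other roots, since there are no zero divisors.
  roots≤degree : ∀ cs k (r : Fin k → Carrier) →
    (∀ {i j} → r i ≈ r j → i ≡ j) → (∀ i → monicAt cs (r i) ≈ 0#) →
    k ℕ.≤ length cs
  roots≤degree cs       zero    r inj root = z≤n
  roots≤degree []       (suc k) r inj root = contradiction (root zero) 1≉0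
  roots≤degree (c ∷ cs) (suc k) r inj root = s≤s (≡.subst (k ℕ.≤_)
    (length-deflate a c cs)
    (roots≤degree (deflate a c cs) k (r ∘ suc) (Finₚ.suc-injective ∘ inj) root′))
    where
    a = r zero
    root′ : ∀ i → monicAt (deflate a c cs) (r (suc i)) ≈ 0#
    root′ i with noZeroDivisors (a - x) q eq
      where
      x = r (suc i)
      q = monicAt (deflate a c cs) x
      aq≈xq : a * q ≈ x * q
      aq≈xq = begin
        a * q                        ≈⟨ +-identityˡ _ ⟨
        0# + a * q                   ≈⟨ +-congʳ (root (suc i)) ⟨
        monicAt (c ∷ cs) x + a * q   ≈⟨ deflate-correct a c cs x ⟩
        monicAt (c ∷ cs) a + x * q   ≈⟨ +-congʳ (root zero) ⟩
        0# + x * q                   ≈⟨ +-identityˡ _ ⟩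
        x * q                        ∎
      eq : (a - x) * q ≈ 0#
      eq = begin
        (a - x) * q      ≈⟨ distribʳ q a (- x) ⟩
        a * q + - x * q  ≈⟨ +-cong aq≈xq (sym (-‿distribˡ-* x q)) ⟩
        x * q - x * q    ≈⟨ -‿inverseʳ (x * q) ⟩
        0#               ∎
    ... | inj₁ a-x≈0 = contradiction (inj (x∙y⁻¹≈ε⇒x≈y _ _ a-x≈0)) λ ()
    ... | inj₂ q≈0   = q≈0

  monicAt-X^ : ∀ k x → monicAt (replicate k 0#) x ≈ x ^ k
  monicAt-X^ zero    x = refl
  monicAt-X^ (suc k) x = trans (+-identityˡ _) (*-congˡ (monicAt-X^ k x))

  module FiniteDomain (fin : Finite setoid) where
    open Inverse (proj₂ fin)

    -- By pigeonhole `x ^ i ≈ x ^ j` for some i < j, and `x ^ i` cancels. With the exponent in the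
    -- form `suc k`, the power `x ^ k` is an inverse of `x`.
    ^-torsion : ∀ x → ¬ (x ≈ 0#) → ∃ λ k → x ^ suc k ≈ 1#
    ^-torsion x x≉0
      with i , j , i<j , eq ← Finₚ.pigeonhole (ℕₚ.n<1+n (proj₁ fin)) (λ i → to (x ^ toℕ i))
      with k , i+1+k≡j ← ℕₚ.m≤n⇒∃[o]m+o≡n i<j
      = k , sym (*-cancelˡ 1# (x ^ suc k) (^-nonzero (toℕ i) x≉0) (begin
        x ^ toℕ i * 1#          ≈⟨ *-identityʳ _ ⟩
        x ^ toℕ i               ≈⟨ strictlyInverseʳ _ ⟨
        from (to (x ^ toℕ i))   ≈⟨ from-cong eq ⟩
        from (to (x ^ toℕ j))   ≈⟨ strictlyInverseʳ _ ⟩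
        x ^ toℕ j               ≈⟨ ^-congʳ x (≡.trans (ℕₚ.+-suc (toℕ i) k) i+1+k≡j) ⟨
        x ^ (toℕ i ℕ.+ suc k)   ≈⟨ ^-homo-* x (toℕ i) (suc k) ⟩
        x ^ toℕ i * x ^ suc k   ∎))

    invertible : ∀ x → ¬ (x ≈ 0#) → ∃ λ y → x * y ≈ 1#
    invertible x x≉0 with k , eq ← ^-torsion x x≉0 = x ^ k , eq

  module UnitGroup (m : ℕ) (inv : Inverse setoid (≡.setoid (Fin (suc m)))) where
    open Inverse inv
    open FiniteDomain (suc m , inv)
    open CommutativeMonoidSum *-commutativeMonoid
      using () renaming (sum to ∏; sum-permute to ∏-permute; sum-replicate to ∏-replicate;
                         sum-cong-≋ to ∏-cong; ∑-distrib-+ to ∏-distrib-*)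

    open Injection (Inverse⇒Injection inv) using () renaming (injective to to-injective)
    -- Of the `suc m` indices, `punchIn (to 0#)` skips that of zero, so `Fin m` enumerates the
    -- nonzero elements.
    unitAt : Fin m → Carrier
    unitAt j = from (punchIn (to 0#) j)

    to-unitAt : ∀ j → to (unitAt j) ≡ punchIn (to 0#) j
    to-unitAt j = strictlyInverseˡ _

    unitAt-nonzero : ∀ j → ¬ (unitAt j ≈ 0#)
    unitAt-nonzero j eq =
      Finₚ.punchInᵢ≢i (to 0#) j (≡.trans (≡.sym (to-unitAt j)) (to-cong eq))

    unitAt-injective : ∀ {i j} → unitAt i ≈ unitAt j → i ≡ j
    unitAt-injective {i} {j} eq = Finₚ.punchIn-injective (to 0#) i j
      (≡.trans (≡.sym (to-unitAt i)) (≡.trans (to-cong eq) (to-unitAt j)))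

    index : ∀ x → ¬ (x ≈ 0#) → Fin m
    index x x≉0 = punchOut {i = to 0#} {j = to x} (x≉0 ∘ sym ∘ to-injective)

    unitAt-index : ∀ x x≉0 → unitAt (index x x≉0) ≈ x
    unitAt-index x x≉0 =
      trans (from-cong (Finₚ.punchIn-punchOut _)) (strictlyInverseʳ x)

    ∏-nonzero : ∀ {k} (f : Fin k → Carrier) → (∀ i → ¬ (f i ≈ 0#)) → ¬ (∏ f ≈ 0#)
    ∏-nonzero {zero}  f f≉0 = 1≉0
    ∏-nonzero {suc k} f f≉0 = *-nonzero (f≉0 zero) (∏-nonzero (f ∘ suc) (f≉0 ∘ suc))

    scale : ∀ x → ¬ (x ≈ 0#) → Fin m → Fin m
    scale x x≉0 j = index (x * unitAt j) (*-nonzero x≉0 (unitAt-nonzero j))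

    unitAt-scale : ∀ x x≉0 j → unitAt (scale x x≉0 j) ≈ x * unitAt j
    unitAt-scale x x≉0 j = unitAt-index (x * unitAt j) (*-nonzero x≉0 (unitAt-nonzero j))

    scale-inverse : ∀ {x y} x≉0 y≉0 → x * y ≈ 1# → ∀ j → scale x x≉0 (scale y y≉0 j) ≡ j
    scale-inverse {x} {y} x≉0 y≉0 xy≈1 j = unitAt-injective (begin
      unitAt (scale x x≉0 (scale y y≉0 j))  ≈⟨ unitAt-scale x x≉0 _ ⟩
      x * unitAt (scale y y≉0 j)            ≈⟨ *-congˡ (unitAt-scale y y≉0 j) ⟩
      x * (y * unitAt j)                    ≈⟨ *-assoc x y _ ⟨
      x * y * unitAt j                      ≈⟨ *-congʳ xy≈1 ⟩
      1# * unitAt j                         ≈⟨ *-identityˡ _ ⟩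
      unitAt j                              ∎)

    -- Multiplication by `x` permutes the nonzero elements, so their product is unchanged when
    -- multiplied by `x ^ m`; being nonzero, it cancels.
    fermat : ∀ x → ¬ (x ≈ 0#) → x ^ m ≈ 1#
    fermat x x≉0 with y , xy≈1 ← invertible x x≉0 =
      *-cancelˡ (x ^ m) 1# (∏-nonzero unitAt unitAt-nonzero) (begin
        ∏ unitAt * x ^ m                   ≈⟨ *-comm _ _ ⟩
        x ^ m * ∏ unitAt                   ≈⟨ *-congʳ (∏-replicate m) ⟨
        ∏ {m} (λ _ → x) * ∏ unitAt         ≈⟨ ∏-distrib-* (λ _ → x) unitAt ⟨
        ∏ (λ j → x * unitAt j)             ≈⟨ ∏-cong (unitAt-scale x x≉0) ⟨
        ∏ (unitAt ∘ scale x x≉0)           ≈⟨ ∏-permute unitAt π ⟨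
        ∏ unitAt                           ≈⟨ *-identityʳ _ ⟨
        ∏ unitAt * 1#                      ∎)
      where
      y≉0 : ¬ (y ≈ 0#)
      y≉0 y≈0 = 1≉0 (trans (sym xy≈1) (trans (*-congˡ y≈0) (zeroʳ x)))
      π : Perm.Permutation m m
      π = Perm.permutation (scale x x≉0) (scale y y≉0)
        (scale-inverse x≉0 y≉0 xy≈1) (scale-inverse y≉0 x≉0 (trans (*-comm y x) xy≈1))

    -- If m ∤ k, then Xʳ − 1 with r = k mod m has too many roots.
    order∣exponent : ∀ k → (∀ x → ¬ (x ≈ 0#) → x ^ k ≈ 1#) → m ∣ k
    order∣exponent k x^k≈1 = byRemainder (k % m) ≡.refl
      where
      instance
        m≢0 : ℕ.NonZero m
        m≢0 = Finₚ.nonZeroIndex (index 1# 1≉0)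

      remainder : ∀ x → ¬ (x ≈ 0#) → x ^ (k % m) ≈ 1#
      remainder x x≉0 = begin
        x ^ (k % m)                              ≈⟨ *-identityʳ _ ⟨
        x ^ (k % m) * 1#                         ≈⟨ *-congˡ (fermat (x ^ q) (^-nonzero q x≉0)) ⟨
        x ^ (k % m) * (x ^ q) ^ m                ≈⟨ *-congˡ (^-assocʳ x q m) ⟩
        x ^ (k % m) * x ^ (q ℕ.* m)              ≈⟨ ^-homo-* x (k % m) (q ℕ.* m) ⟨
        x ^ (k % m ℕ.+ q ℕ.* m)                  ≈⟨ ^-congʳ x (m≡m%n+[m/n]*n k m) ⟨
        x ^ k                                    ≈⟨ x^k≈1 x x≉0 ⟩
        1#                                       ∎
        where q = k ℕ./ m

      byRemainder : ∀ r → r ≡ k % m → m ∣ k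
      byRemainder zero    eq = m%n≡0⇒n∣m k m (≡.sym eq)
      -- The list `- 1# ∷ replicate r 0#` stands for X^(r+1) - 1, the leading 1 being implicit. All
      -- `m` units are roots, so `m ≤ suc r`, against `k % m < m`.
      byRemainder (suc r) eq = contradiction (m%n<n k m) (ℕₚ.≤⇒≯ (≡.subst (m ℕ.≤_)
        (≡.trans (≡.cong suc (length-replicate r)) eq)
        (roots≤degree (- 1# ∷ replicate r 0#) m unitAt unitAt-injective λ j → begin
          - 1# + unitAt j * monicAt (replicate r 0#) (unitAt j)
            ≈⟨ +-congˡ (*-congˡ (monicAt-X^ r (unitAt j))) ⟩
          - 1# + unitAt j ^ suc r
            ≈⟨ +-congˡ (^-congʳ (unitAt j) eq) ⟩
          - 1# + unitAt j ^ (k % m)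
            ≈⟨ +-congˡ (remainder (unitAt j) (unitAt-nonzero j)) ⟩
          - 1# + 1#
            ≈⟨ -‿inverseˡ 1# ⟩
          0# ∎)))

  card-1∣exponent : (fin : Finite setoid) → ∀ k → (∀ x → ¬ (x ≈ 0#) → x ^ k ≈ 1#) →
                    (card fin ∸ 1) ∣ k
  card-1∣exponent (zero  , inv) with () ← Inverse.to inv 0#
  card-1∣exponent (suc m , inv) = UnitGroup.order∣exponent m inv

  x^[card-1]≈1 : (fin : Finite setoid) → ∀ x → ¬ (x ≈ 0#) → x ^ (card fin ∸ 1) ≈ 1#
  x^[card-1]≈1 (zero  , inv) with () ← Inverse.to inv 0#
  x^[card-1]≈1 (suc m , inv) = UnitGroup.fermat m inv

-- Finiteness of surjective images.

module _ {a b} (S : Setoid a b) (_≟_ : Decidable (Setoid._≈_ S)) where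
  open Setoid S

  -- Decidable equality allows a value to be dropped whenever it occurs again later, so the
  -- enumeration becomes injective without losing values.
  deduplicate : ∀ n (f : Fin n → Carrier) → ∃ λ m → Σ (Fin m → Carrier) λ g →
    (∀ {i j} → g i ≈ g j → i ≡ j) × (∀ i → ∃ λ j → g j ≈ f i)
  deduplicate zero    f = 0 , (λ ()) , (λ { {()} }) , λ ()
  deduplicate (suc n) f with m , g , inj , cover ← deduplicate n (f ∘ suc)
    with Finₚ.any? (λ j → g j ≟ f zero)
  ... | yes found = m , g , inj , λ { zero → found ; (suc i) → cover i }
  ... | no  ¬found = suc m , g′ , inj′ , cover′
    where
    g′ : Fin (suc m) → Carrier
    g′ zero    = f zero
    g′ (suc j) = g j
    inj′ : ∀ {i j} → g′ i ≈ g′ j → i ≡ j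
    inj′ {zero}  {zero}  eq = ≡.refl
    inj′ {zero}  {suc j} eq = contradiction (j , sym eq) ¬found
    inj′ {suc i} {zero}  eq = contradiction (i , eq) ¬found
    inj′ {suc i} {suc j} eq = ≡.cong suc (inj eq)
    cover′ : ∀ i → ∃ λ j → g′ j ≈ f i
    cover′ zero    = zero , refl
    cover′ (suc i) with j , eq ← cover i = suc j , eq

  surjection⇒finite : ∀ n (f : Fin n → Carrier) → (∀ x → ∃ λ i → f i ≈ x) → Finite S
  surjection⇒finite n f surj with m , g , inj , cover ← deduplicate n f = m , record
    { to        = index
    ; from      = g
    ; to-cong   = λ {x} {y} x≈y → inj (trans (g-index x) (trans x≈y (sym (g-index y))))
    ; from-cong = λ { ≡.refl → refl }
    ; inverse   = (λ y≈gi → inj (trans (g-index _) y≈gi))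
                , (λ { {x} ≡.refl → g-index x })
    }
    where
    index : Carrier → Fin m
    index x = proj₁ (cover (proj₁ (surj x)))
    g-index : ∀ x → g (index x) ≈ x
    g-index x = trans (proj₂ (cover (proj₁ (surj x)))) (proj₂ (surj x))

-- Quotients and products of ideals.

module IdealTheory {c ℓ : Level} (O : CommutativeRing c ℓ) where
  open CommutativeRing O hiding (zero)
  open Ideal
  open RingProps ring using (-‿distribʳ-*; -0#≈0#)
  open GroupProps +-group using (//-rightDividesˡ)
  open CommutativeSemigroupProps *-commutativeSemigroup using (x∙yz≈y∙xz)
  open CommutativeSemiringExp commutativeSemiring using (_^_)
  open IsPrime

  module Quotient (I : Ideal O) = CommutativeRing (quotient I)

  x-0≈x : ∀ x → x - 0# ≈ x
  x-0≈x x = trans (+-congˡ -0#≈0#) (+-identityʳ x)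

  x+[1-x]≈1 : ∀ x → x + (1# - x) ≈ 1#
  x+[1-x]≈1 x = trans (+-comm x (1# - x)) (//-rightDividesˡ x 1#)

  module _ (I : Ideal O) where

    ≈⇒~ : ∀ {x y} → x ≈ y → (x - y) ∈ I
    ≈⇒~ x≈y = resp I (sym (trans (+-congʳ x≈y) (-‿inverseʳ _))) (0∈ I)

    ∈⇒~0 : ∀ {x} → x ∈ I → (x - 0#) ∈ I
    ∈⇒~0 = resp I (sym (x-0≈x _))

    ~0⇒∈ : ∀ {x} → (x - 0#) ∈ I → x ∈ I
    ~0⇒∈ = resp I (x-0≈x _)

    ~-∈ : ∀ {x y} → (x - y) ∈ I → y ∈ I → x ∈ I
    ~-∈ x~y y∈I = ~0⇒∈ (Quotient.trans I x~y (∈⇒~0 y∈I))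

    absorbʳ : ∀ r {x} → x ∈ I → (x * r) ∈ I
    absorbʳ r x∈I = resp I (*-comm r _) (absorb I r x∈I)

    -- The quotient keeps the carrier and multiplication of `O`, so the two power functions agree
    -- propositionally, not just modulo `I`.
    ^-quotient : ∀ x k → CommutativeSemiringExp._^_ (Quotient.commutativeSemiring I) x k ≡ x ^ k
    ^-quotient x zero    = ≡.refl
    ^-quotient x (suc k) = ≡.cong (x *_) (^-quotient x k)

    finite⇒∈? : FiniteNorm I → ∀ x → Dec (x ∈ I)
    finite⇒∈? fin x = map′ ~0⇒∈ ∈⇒~0 (finite⇒decidable (Quotient.setoid I) fin x 0#)

    -- The class of `0#` excludes norm 0, so `∸ 1` is a true predecessor.
    norm≡suc : (fin : FiniteNorm I) → norm I fin ≡ suc (norm I fin ∸ 1)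
    norm≡suc (zero  , inv) with () ← Inverse.to inv 0#
    norm≡suc (suc m , inv) = ≡.refl

  -- O/I maps onto O/J; decidable membership in `J` is what allows repeated classes to be removed.
  ⊆-finiteNorm : ∀ {I J : Ideal O} → I ⊆ J → (∀ x → Dec (x ∈ J)) → FiniteNorm I → FiniteNorm J
  ⊆-finiteNorm {I} {J} I⊆J ∈J? (n , inv) =
    surjection⇒finite (Quotient.setoid J) (λ x y → ∈J? (x - y)) n from
      (λ x → to x , I⊆J (strictlyInverseʳ x))
    where open Inverse {From = Quotient.setoid I} {To = ≡.setoid (Fin n)} inv

  ∈-· : ∀ {I J : Ideal O} {a b} → a ∈ I → b ∈ J → (a * b) ∈ (I · J)
  ∈-· a∈I b∈J = more a∈I b∈J (none refl) (sym (+-identityʳ _))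

  ·-elim : ∀ {I J : Ideal O} (K : Ideal O) → (∀ {a b} → a ∈ I → b ∈ J → (a * b) ∈ K) → I · J ⊆ K
  ·-elim K ab∈K (none x≈0)           = resp K (sym x≈0) (0∈ K)
  ·-elim K ab∈K (more a∈I b∈J y eq) =
    resp K (sym eq) (+-closed K (ab∈K a∈I b∈J) (·-elim K ab∈K y))

  ·-monoˡ : ∀ (K : Ideal O) {I J : Ideal O} → I ⊆ J → I · K ⊆ J · K
  ·-monoˡ K {J = J} I⊆J = ·-elim (J · K) λ a∈I b∈K → ∈-· {J} {K} (I⊆J a∈I) b∈K

  ·-monoʳ : ∀ (K : Ideal O) {I J : Ideal O} → I ⊆ J → K · I ⊆ K · J
  ·-monoʳ K {J = J} I⊆J = ·-elim (K · J) λ a∈K b∈I → ∈-· {K} {J} a∈K (I⊆J b∈I)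

  ·⊆ˡ : ∀ (I J : Ideal O) → I · J ⊆ I
  ·⊆ˡ I J = ·-elim I λ {_} {b} a∈I _ → absorbʳ I b a∈I

  ⊆·1 : ∀ (I : Ideal O) → I ⊆ I ^ᴵ 1
  ⊆·1 I x∈I = resp (I ^ᴵ 1) (*-identityʳ _) (∈-· {I} {unitIdeal} x∈I unit)

  ·-leftComm : ∀ (I J K : Ideal O) → I · (J · K) ⊆ J · (I · K)
  ·-leftComm I J K = ·-elim (J · (I · K)) move
    where
    move : ∀ {a x} → a ∈ I → x ∈ (J · K) → (a * x) ∈ (J · (I · K))
    move {a} a∈I (none x≈0) = none (trans (*-congˡ x≈0) (zeroʳ a))
    move {a} a∈I (more j∈J k∈K y eq) =
      more j∈J (∈-· {I} {K} a∈I k∈K) (move a∈I y)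
        (trans (*-congˡ eq) (trans (distribˡ a _ _) (+-congʳ (x∙yz≈y∙xz a _ _))))

  ∣-respʳ-≐ : ∀ {I J K : Ideal O} → J ≐ K → I ∣ᴵ K → I ∣ᴵ J
  ∣-respʳ-≐ (J⊆K , K⊆J) (L , K⊆IL , IL⊆K) =
    L , (λ x∈J → K⊆IL (J⊆K x∈J)) , (λ x∈IL → K⊆J (IL⊆K x∈IL))

  Simple : List (Ideal O × ℕ) → Set (lsuc (c ⊔ ℓ))
  Simple = All (λ f → proj₂ f ≡ 1)

  -- The cofactor of the head is the product of the tail. For a later factor, `·-leftComm` moves the
  -- head into the cofactor.
  factor∣primePowers : ∀ {fs} → Simple fs → All (λ f → proj₁ f ∣ᴵ primePowers fs) fs
  factor∣primePowers [] = []
  factor∣primePowers {(P , _) ∷ fs} (≡.refl ∷ simple) =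
    (R , ·-monoˡ R {P ^ᴵ 1} {P} (·⊆ˡ P unitIdeal) , ·-monoˡ R {P} {P ^ᴵ 1} (⊆·1 P))
    ∷ All.map (λ {f} → ∣-·ˡ {proj₁ f}) (factor∣primePowers simple)
    where
    R = primePowers fs
    ∣-·ˡ : ∀ {Q : Ideal O} → Q ∣ᴵ R → Q ∣ᴵ (P ^ᴵ 1 · R)
    ∣-·ˡ {Q} (K , R⊆QK , QK⊆R) =
      P ^ᴵ 1 · K ,
      (λ x∈PR → ·-leftComm (P ^ᴵ 1) Q K (·-monoʳ (P ^ᴵ 1) {R} {Q · K} R⊆QK x∈PR)) ,
      (λ x∈QPK → ·-monoʳ (P ^ᴵ 1) {Q · K} {R} QK⊆R (·-leftComm Q (P ^ᴵ 1) K x∈QPK))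

  -- Comaximal ideals.

  Comaximal : Ideal O → Ideal O → Set (c ⊔ ℓ)
  Comaximal I J = ∃ λ x → ∃ λ y → x ∈ I × y ∈ J × x + y ≈ 1#

  comaximal-sym : ∀ {I J : Ideal O} → Comaximal I J → Comaximal J I
  comaximal-sym (x , y , x∈I , y∈J , eq) = y , x , y∈J , x∈I , trans (+-comm y x) eq

  comaximal-distinct : ∀ {I J : Ideal O} → IsProper J → Comaximal I J → ¬ (I ≐ J)
  comaximal-distinct {J = J} J≠1 (x , y , x∈I , y∈J , eq) (I⊆J , _) =
    J≠1 (resp J eq (+-closed J (I⊆J x∈I) y∈J))

  -- Write 1 = u + u′ (v + v′) and group the terms as (u + u′ v) + u′ v′.
  comaximal-· : ∀ {I J K : Ideal O} → Comaximal I J → Comaximal I K → Comaximal I (J · K)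
  comaximal-· {I} {J} {K} (u , u′ , u∈I , u′∈J , eq) (v , v′ , v∈I , v′∈K , eq′) =
    u + u′ * v , u′ * v′ , +-closed I u∈I (absorb I u′ v∈I) , ∈-· {J} {K} u′∈J v′∈K ,
    (begin
      (u + u′ * v) + u′ * v′  ≈⟨ +-assoc u _ _ ⟩
      u + (u′ * v + u′ * v′)  ≈⟨ +-congˡ (distribˡ u′ v v′) ⟨
      u + u′ * (v + v′)       ≈⟨ +-congˡ (*-congˡ eq′) ⟩
      u + u′ * 1#             ≈⟨ +-congˡ (*-identityʳ u′) ⟩
      u + u′                  ≈⟨ eq ⟩
      1#                      ∎)
    where open SetoidReasoning setoid

  comaximal-mono : ∀ {I I′ J J′ : Ideal O} → I ⊆ I′ → J ⊆ J′ → Comaximal I J → Comaximal I′ J′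
  comaximal-mono I⊆ J⊆ (x , y , x∈ , y∈ , eq) = x , y , I⊆ x∈ , J⊆ y∈ , eq

  comaximal-unit : ∀ I → Comaximal I unitIdeal
  comaximal-unit I = 0# , 1# , 0∈ I , unit , +-identityˡ 1#

  -- With u + v = 1, x = u x + x v, and each summand is a product of an element of `I` and one of
  -- `J`.
  comaximal⇒∩⊆· : ∀ {I J : Ideal O} {x} → Comaximal I J → x ∈ I → x ∈ J → x ∈ (I · J)
  comaximal⇒∩⊆· {I} {J} {x} (u , v , u∈I , v∈J , eq) x∈I x∈J =
    more u∈I x∈J (∈-· {I} {J} x∈I v∈J) (begin
      x              ≈⟨ *-identityʳ x ⟨
      x * 1#         ≈⟨ *-congˡ eq ⟨
      x * (u + v)    ≈⟨ distribˡ x u v ⟩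
      x * u + x * v  ≈⟨ +-congʳ (*-comm x u) ⟩
      u * x + x * v  ∎)
    where open SetoidReasoning setoid

  comaximal-primePowers : ∀ {I : Ideal O} {fs} → Simple fs → All (Comaximal I ∘ proj₁) fs →
                          Comaximal I (primePowers fs)
  comaximal-primePowers {I} [] [] = comaximal-unit I
  comaximal-primePowers {I} {(P , _) ∷ fs} (≡.refl ∷ simple) (cm ∷ cms) =
    comaximal-· {I} {P ^ᴵ 1} {primePowers fs}
      (comaximal-mono {I} {I} {P} {P ^ᴵ 1} (λ x → x) (⊆·1 P) cm)
      (comaximal-primePowers {I} {fs} simple cms)

  -- Induction on the list: the head is comaximal with the product of the tail, so their
  -- intersection lies in their product.
  ⋂⊆primePowers : ∀ {fs} → Simple fs →
    AllPairs (λ f g → Comaximal (proj₁ f) (proj₁ g)) fs →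
    ∀ {x} → All (λ f → x ∈ proj₁ f) fs → x ∈ primePowers fs
  ⋂⊆primePowers [] [] [] = unit
  ⋂⊆primePowers {(P , _) ∷ fs} (≡.refl ∷ simple) (cms ∷ rest) (x∈P ∷ x∈fs) =
    comaximal⇒∩⊆· {P ^ᴵ 1} {primePowers fs}
      (comaximal-mono {P} {P ^ᴵ 1} {R} {R} (⊆·1 P) (λ x → x)
        (comaximal-primePowers {P} {fs} simple cms))
      (⊆·1 P x∈P) (⋂⊆primePowers simple rest x∈fs)
    where R = primePowers fs

  ∣⇒⊇ : ∀ {I J : Ideal O} → I ∣ᴵ J → J ⊆ I
  ∣⇒⊇ {I} (K , J⊆IK , _) x∈J = ·⊆ˡ I K (J⊆IK x∈J)

  -- Power congruences modulo a prime ideal of finite norm.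

  module PrimeQuotient (P : Ideal O) (P-prime : IsPrime P) where
    module ℚ = Quotient P

    quotient-domain : IsIntegralDomain (quotient P)
    quotient-domain = record
      { 1≉0            = proper P-prime ∘ ~0⇒∈ P
      ; noZeroDivisors = λ x y xy~0 →
          ⊎-map (∈⇒~0 P) (∈⇒~0 P) (split P-prime x y (~0⇒∈ P xy~0))
      }

    open Domain (quotient P) quotient-domain
      public using (*-cancelˡ; module FiniteDomain; card-1∣exponent; x^[card-1]≈1)

    open CommutativeSemiringExp ℚ.commutativeSemiring
      using () renaming (_^_ to _^′_; ^-congʳ to ^′-congʳ; ^-congˡ to ^′-congˡ; ^-assocʳ to ^′-assocʳ)

    -- Cancelling one `x` outside `P` turns the congruence into x^k = 1 for all units.
    power⇒norm-1∣ : (fin : FiniteNorm P) → ∀ k → (∀ x → (x ^ suc k - x) ∈ P) →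
                    (norm P fin ∸ 1) ∣ k
    power⇒norm-1∣ fin k x^k+1~x = card-1∣exponent fin k λ x x≁0 → *-cancelˡ (x ^′ k) 1# x≁0
      (≡.subst (λ z → (x * z - x * 1#) ∈ P) (≡.sym (^-quotient P x k))
        (ℚ.trans (x^k+1~x x) (≈⇒~ P (sym (*-identityʳ x)))))

    1^k~1 : ∀ q → (1# ^′ q - 1#) ∈ P
    1^k~1 zero    = ℚ.refl
    1^k~1 (suc q) = ℚ.trans (ℚ.*-identityˡ _) (1^k~1 q)

    -- For `x` in `P` both sides vanish; otherwise x^k is a power of x^(Q-1), which is 1 by Fermat,
    -- Q being the norm of `P`.
    norm-1∣⇒power : (fin : FiniteNorm P) → ∀ k → (norm P fin ∸ 1) ∣ k → ∀ x → (x ^ suc k - x) ∈ P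
    norm-1∣⇒power fin k (divides q k≡q*m) x with finite⇒∈? P fin x
    ... | yes x∈P = ℚ.trans (∈⇒~0 P (absorbʳ P (x ^ k) x∈P)) (ℚ.sym (∈⇒~0 P x∈P))
    ... | no  x∉P = ≡.subst (λ z → (x * z - x) ∈ P) (^-quotient P x k)
        (ℚ.trans (ℚ.*-congˡ x^k~1) (ℚ.*-identityʳ x))
      where
      m = norm P fin ∸ 1
      x^k~1 : (x ^′ k - 1#) ∈ P
      x^k~1 = begin
        x ^′ k             ≈⟨ ^′-congʳ x (≡.trans k≡q*m (ℕₚ.*-comm q m)) ⟩
        x ^′ (m ℕ.* q)     ≈⟨ ^′-assocʳ x m q ⟨
        (x ^′ m) ^′ q      ≈⟨ ^′-congˡ q (x^[card-1]≈1 fin x (x∉P ∘ ~0⇒∈ P)) ⟩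
        1# ^′ q            ≈⟨ 1^k~1 q ⟩
        1#                 ∎
        where open SetoidReasoning ℚ.setoid

  -- Colon ideals and the decomposition of a regular quotient.

  infixl 7 _∶_
  -- The colon ideal. When e + f = 1 and e f ∈ I it equals I + (f), but in this form a membership
  -- test for `I` yields one for `I ∶ e` at once.
  _∶_ : Ideal O → Carrier → Ideal O
  I ∶ e = record
    { member   = λ x → (e * x) ∈ I
    ; resp     = λ x≈y → resp I (*-congˡ x≈y)
    ; 0∈       = resp I (sym (zeroʳ e)) (0∈ I)
    ; +-closed = λ p q → resp I (sym (distribˡ e _ _)) (+-closed I p q)
    ; absorb   = λ r p → resp I (x∙yz≈y∙xz r e _) (absorb I r p)
    }

  ⊆-∶ : ∀ (I : Ideal O) e → I ⊆ I ∶ e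
  ⊆-∶ I e = absorb I e

  -- Von Neumann regularity of a modulo I: a b is idempotent modulo I, with
  -- complement f.
  Regular : Ideal O → Carrier → Set (c ⊔ ℓ)
  Regular I a = ∃ λ b → ∃ λ f → a * b + f ≈ 1# × (a * f) ∈ I

  -- In the second alternative `b` is an inverse of `a` modulo `I`, with error term `f`.
  ZeroOrUnit : Ideal O → Carrier → Set (c ⊔ ℓ)
  ZeroOrUnit I a = a ∈ I ⊎ ∃ λ b → ∃ λ f → a * b + f ≈ 1# × f ∈ I

  regular-mono : ∀ {I J : Ideal O} {a} → I ⊆ J → Regular I a → Regular J a
  regular-mono I⊆J (b , f , eq , af∈I) = b , f , eq , I⊆J af∈I

  zeroOrUnit-mono : ∀ {I J : Ideal O} {a} → I ⊆ J → ZeroOrUnit I a → ZeroOrUnit J a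
  zeroOrUnit-mono I⊆J (inj₁ a∈I)            = inj₁ (I⊆J a∈I)
  zeroOrUnit-mono I⊆J (inj₂ (b , f , eq , f∈I)) = inj₂ (b , f , eq , I⊆J f∈I)

  split-1 : ∀ {e f} x → e + f ≈ 1# → e * x + f * x ≈ x
  split-1 {e} {f} x eq = trans (sym (distribʳ x e f)) (trans (*-congʳ eq) (*-identityˡ x))

  -- By `above` and `covers`, `I` is the intersection of the parts. Once `as` represents every class
  -- modulo `I`, `decides` makes the parts prime.
  record Decomposition (I : Ideal O) (as : List Carrier) : Set (lsuc (c ⊔ ℓ)) where
    field
      parts     : List (Ideal O)
      above     : All (I ⊆_) parts
      covers    : ∀ {x} → All (x ∈_) parts → x ∈ I
      comaximal : AllPairs Comaximal parts
      isProper  : All IsProper parts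
      decides   : All (λ J → All (ZeroOrUnit J) as) parts

  trivial : ∀ {I : Ideal O} → IsProper I → Decomposition I []
  trivial {I} 1∉I = record
    { parts     = I ∷ []
    ; above     = (λ x → x) ∷ []
    ; covers    = All.head
    ; comaximal = [] ∷ []
    ; isProper  = 1∉I ∷ []
    ; decides   = [] ∷ []
    }

  extend : ∀ {I : Ideal O} {a as} → ZeroOrUnit I a → Decomposition I as → Decomposition I (a ∷ as)
  extend {I} a? D = record
    { parts     = parts D
    ; above     = above D
    ; covers    = covers D
    ; comaximal = comaximal D
    ; isProper  = isProper D
    ; decides   = All.zipWith (λ {J} (I⊆J , ds) → zeroOrUnit-mono {I} {J} I⊆J a? ∷ ds)
                    (above D , decides D)
    }
    where open Decomposition

  -- Parts above `I ∶ e` contain `f` and parts above `I ∶ f` contain `e`, so parts from different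
  -- sides are comaximal. The identity x = e x + f x shows that the two colon ideals meet in `I`.
  join : ∀ {I : Ideal O} {e f as} → e + f ≈ 1# → (e * f) ∈ I →
         Decomposition (I ∶ e) as → Decomposition (I ∶ f) as → Decomposition I as
  join {I} {e} {f} e+f≈1 ef∈I D E = record
    { parts     = parts D ++ parts E
    ; above     = Allₚ.++⁺ (restrict e (above D)) (restrict f (above E))
    ; covers    = λ {x} x∈ → resp I (split-1 x e+f≈1) (+-closed I
                    (covers D (Allₚ.++⁻ˡ (parts D) x∈)) (covers E (Allₚ.++⁻ʳ (parts D) x∈)))
    ; comaximal = AllPairsₚ.++⁺ (comaximal D) (comaximal E)
                    (All.map (λ {J} I∶e⊆J → All.map (λ {K} I∶f⊆K →
                      f , e , I∶e⊆J ef∈I , I∶f⊆K (resp I (*-comm e f) ef∈I) ,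
                      trans (+-comm f e) e+f≈1) (above E)) (above D))
    ; isProper  = Allₚ.++⁺ (isProper D) (isProper E)
    ; decides   = Allₚ.++⁺ (decides D) (decides E)
    }
    where
    open Decomposition
    restrict : ∀ g {Js} → All (I ∶ g ⊆_) Js → All (I ⊆_) Js
    restrict g = All.map λ {J} I∶g⊆J {x} x∈I → I∶g⊆J (⊆-∶ I g x∈I)

  -- The membership tests keep all parts proper: `I` is split only if neither colon ideal is the
  -- whole ring.
  decompose : ∀ as (I : Ideal O) → (∀ a → Regular I a) → (∀ x → Dec (x ∈ I)) → IsProper I →
              Decomposition I as
  decompose []       I regular ∈I? 1∉I = trivial 1∉I
  decompose (a ∷ as) I regular ∈I? 1∉I with b , f , eq , af∈I ← regular a
    with ∈I? a | ∈I? f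
  ... | yes a∈I | _       = extend (inj₁ a∈I) (decompose as I regular ∈I? 1∉I)
  ... | no  _   | yes f∈I = extend (inj₂ (b , f , eq , f∈I)) (decompose as I regular ∈I? 1∉I)
  -- Modulo `I ∶ e` the element `a` has inverse `b`, because e f ∈ I; modulo `I ∶ f` it is zero,
  -- because f a ∈ I.
  ... | no  a∉I | no  f∉I = join eq ef∈I
    (extend (inj₂ (b , f , eq , ef∈I)) (branch e e∉I))
    (extend (inj₁ (resp I (*-comm a f) af∈I)) (branch f f∉I))
    where
    e : Carrier
    e = a * b
    ef∈I : (e * f) ∈ I
    ef∈I = resp I (trans (x∙yz≈y∙xz b a f) (sym (*-assoc a b f))) (absorb I b af∈I)
    -- Otherwise a = e a + f a would lie in `I`.
    e∉I : ¬ (e ∈ I)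
    e∉I e∈I = a∉I (resp I (split-1 a eq)
      (+-closed I (absorbʳ I a e∈I) (resp I (*-comm a f) af∈I)))
    branch : ∀ g → ¬ (g ∈ I) → Decomposition (I ∶ g) as
    branch g g∉I = decompose as (I ∶ g)
      (λ x → regular-mono {I} {I ∶ g} (⊆-∶ I g) (regular x)) (λ x → ∈I? (g * x))
      (λ g1∈I → g∉I (resp I (*-identityʳ g) g1∈I))

  -- Let x y ∈ I and let `a` represent `x`. If `a` is a unit modulo `I`, then y = b (a y) + f y lies
  -- in `I`.
  zeroOrUnit⇒prime : ∀ {I : Ideal O} → IsProper I →
    (∀ x → ∃ λ a → (x - a) ∈ I × ZeroOrUnit I a) → IsPrime I
  zeroOrUnit⇒prime {I} 1∉I approx = record { proper = 1∉I ; split = split′ }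
    where
    module Q = Quotient I
    split′ : ∀ x y → (x * y) ∈ I → x ∈ I ⊎ y ∈ I
    split′ x y xy∈I with approx x
    ... | a , x~a , inj₁ a∈I                 = inj₁ (~-∈ I x~a a∈I)
    ... | a , x~a , inj₂ (b , f , eq , f∈I) = inj₂ (resp I (split-1 y eq)
            (+-closed I (resp I (shuffle a) (absorb I b ay∈I)) (absorbʳ I y f∈I)))
      where
      ay∈I : (a * y) ∈ I
      ay∈I = ~-∈ I (Q.*-congʳ {y} (Q.sym x~a)) xy∈I
      shuffle : ∀ a → b * (a * y) ≈ a * b * y
      shuffle a = trans (x∙yz≈y∙xz b a y) (sym (*-assoc a b y))

  -- Primality puts `x` or its complement `f` in `P`, and x b + f = 1 forbids both. This tests
  -- membership before the norm of `P` is known to be finite.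
  prime-∈? : ∀ {I P : Ideal O} → IsPrime P → I ⊆ P → (∀ a → Regular I a) → ∀ x → Dec (x ∈ P)
  prime-∈? {I} {P} prime I⊆P regular x with b , f , eq , xf∈I ← regular x
    with split prime x f (I⊆P xf∈I)
  ... | inj₁ x∈P = yes x∈P
  ... | inj₂ f∈P = no λ x∈P → proper prime (resp P eq (+-closed P (absorbʳ P b x∈P) f∈P))

  -- From the Carmichael property to the three conditions.

  module Forward (n : Ideal O) (1∉n : IsProper n) (carmichael : IsCarmichaelIdeal n) where
    open IsCarmichaelRing carmichael

    power′ : ∀ a → (a ^ norm n finite - a) ∈ n
    power′ a = ≡.subst (λ z → (z - a) ∈ n) (^-quotient n a (norm n finite)) (power a)

    regular : ∀ a → Regular n a
    regular a with ℕₚ.m≤n⇒∃[o]m+o≡n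
      (≉⇒1<card (Quotient.setoid n) finite {1#} {0#} (1∉n ∘ ~0⇒∈ n))
    -- Here k = N - 2, and `a * e` unfolds to `a ^ (2 + k)`, so a (1 - e) = a - a^N.
    ... | k , 2+k≡N = a ^ k , 1# - e , x+[1-x]≈1 e , ~0⇒∈ n (begin
        a * (1# - e)        ≈⟨ ≈⇒~ n (distribˡ a 1# (- e)) ⟩
        a * 1# + a * - e    ≈⟨ ≈⇒~ n (+-cong (*-identityʳ a) (sym (-‿distribʳ-* a e))) ⟩
        a - a * e           ≈⟨ Q.+-congʳ (Q.sym ae~a) ⟩
        a * e - a * e       ≈⟨ Q.-‿inverseʳ (a * e) ⟩
        0#                  ∎)
      where
      module Q = Quotient n
      open SetoidReasoning Q.setoid
      e : Carrier
      e = a * a ^ k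
      ae~a : (a * e - a) ∈ n
      ae~a = ≡.subst (λ N → (a ^ N - a) ∈ n) (≡.sym 2+k≡N) (power′ a)

    representatives : List Carrier
    representatives = tabulate (Inverse.from (proj₂ finite))

    open Decomposition (decompose representatives n regular (finite⇒∈? n finite) 1∉n)

    -- Every `x` is congruent modulo `n`, hence modulo each part, to a listed representative, which
    -- is zero or a unit there.
    prime-parts : All IsPrime parts
    prime-parts = All.zipWith (λ {J} (n⊆J , 1∉J , ds) → zeroOrUnit⇒prime 1∉J λ x →
        Inverse.from inv (Inverse.to inv x) ,
        n⊆J (Quotient.sym n (Inverse.strictlyInverseʳ inv x)) ,
        Allₚ.tabulate⁻ ds (Inverse.to inv x))
      (above , All.zip (isProper , decides))
      where inv = proj₂ finite

    factorList : List (Ideal O × ℕ)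
    factorList = map (_, 1) parts

    squareFree : IsSquareFree n
    squareFree = record
      { factors   = factorList
      ; prime     = Allₚ.map⁺ prime-parts
      ; positive  = Allₚ.map⁺ (All.universal (λ _ → s≤s z≤n) parts)
      ; distinct  = AllPairsₚ.map⁺ (distinct parts isProper comaximal)
      -- The ideal `n` is the intersection of its parts, and comaximality turns the intersection
      -- into the product.
      ; factorise = (λ x∈n → ⋂⊆primePowers simple (AllPairsₚ.map⁺ comaximal)
                              (Allₚ.map⁺ (All.map (λ n⊆J → n⊆J x∈n) above)))
                  , (λ x∈∏ → covers (Allₚ.map⁻ (All.map
                      (λ {f} f∣∏ → ∣⇒⊇ {proj₁ f} {primePowers factorList} f∣∏ x∈∏)
                      (factor∣primePowers simple))))
      } , simple
      where
      simple : Simple factorList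
      simple = Allₚ.map⁺ (All.universal (λ _ → ≡.refl) parts)
      distinct : ∀ Js → All IsProper Js → AllPairs Comaximal Js →
                 AllPairs (λ J K → ¬ (J ≐ K)) Js
      distinct [] [] [] = []
      distinct (J ∷ Js) (_ ∷ 1∉Js) (cs ∷ css) =
        All.zipWith (λ {K} (1∉K , c) → comaximal-distinct {J} {K} 1∉K c) (1∉Js , cs)
        ∷ distinct Js 1∉Js css

    -- Regularity makes membership in `p` decidable, so finiteness passes from O/n to O/p; so does
    -- the congruence a^N ≡ a.
    norms : ∀ (p : Ideal O) → IsPrime p → p ∣ᴵ n →
            Σ (FiniteNorm p) λ finₚ → (norm p finₚ ∸ 1) ∣ (norm n finite ∸ 1)
    norms p prime p∣n = finₚ , PrimeQuotient.power⇒norm-1∣ p prime finₚ (norm n finite ∸ 1)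
        (λ x → n⊆p (≡.subst (λ N → (x ^ N - x) ∈ n) (norm≡suc n finite) (power′ x)))
      where
      n⊆p : n ⊆ p
      n⊆p = ∣⇒⊇ {p} {n} p∣n
      finₚ : FiniteNorm p
      finₚ = ⊆-finiteNorm {n} {p} n⊆p (prime-∈? {n} {p} prime n⊆p regular) finite

  -- From the three conditions to the Carmichael property.

  -- The finite domain O/Q is a field, so `x` has an inverse `y` there, and 1 = x y + (1 - x y).
  ⊈-comaximal : ∀ {P Q : Ideal O} {x} → IsPrime Q → FiniteNorm Q →
                x ∈ P → ¬ (x ∈ Q) → Comaximal P Q
  ⊈-comaximal {P} {Q} {x} prime fin x∈P x∉Q =
    let y , xy~1 = PrimeQuotient.FiniteDomain.invertible Q prime fin x (x∉Q ∘ ~0⇒∈ Q)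
    in x * y , 1# - x * y , absorbʳ P y x∈P , Quotient.sym Q xy~1 , x+[1-x]≈1 (x * y)

  module Backward (n : Ideal O) (finₙ : FiniteNorm n) where
    open Inverse (proj₂ finₙ) using (to; from; strictlyInverseʳ)

    -- Ideals above `n` are unions of classes modulo `n`, so inclusion is settled by searching
    -- finitely many representatives.
    ⊆-or-witness : ∀ {P Q : Ideal O} → n ⊆ P → n ⊆ Q →
      (∀ x → Dec (x ∈ P)) → (∀ x → Dec (x ∈ Q)) → P ⊆ Q ⊎ ∃ λ x → x ∈ P × ¬ (x ∈ Q)
    ⊆-or-witness {P} {Q} n⊆P n⊆Q ∈P? ∈Q?
      with Finₚ.any? (λ i → ∈P? (from i) ×-dec ¬? (∈Q? (from i)))
    ... | yes (i , ∈P , ∉Q) = inj₂ (from i , ∈P , ∉Q)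
    ... | no  none-outside = inj₁ P⊆Q
      where
      P⊆Q : P ⊆ Q
      P⊆Q {x} x∈P with ∈Q? (from (to x))
      ... | yes r∈Q = ~-∈ Q (Quotient.sym Q (n⊆Q (strictlyInverseʳ x))) r∈Q
      ... | no  r∉Q = contradiction (to x , ~-∈ P (n⊆P (strictlyInverseʳ x)) x∈P , r∉Q) none-outside

    record FinitePrimeAbove (P : Ideal O) : Set (c ⊔ ℓ) where
      field
        n⊆P   : n ⊆ P
        prime : IsPrime P
        fin   : FiniteNorm P
        norm∣ : (norm P fin ∸ 1) ∣ (norm n finₙ ∸ 1)

    distinct⇒comaximal : ∀ {P Q : Ideal O} → FinitePrimeAbove P → FinitePrimeAbove Q →
      ¬ (P ≐ Q) → Comaximal P Q
    distinct⇒comaximal {P} {Q} p q P≢Q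
      with ⊆-or-witness {P} {Q} p.n⊆P q.n⊆P (finite⇒∈? P p.fin) (finite⇒∈? Q q.fin)
         | ⊆-or-witness {Q} {P} q.n⊆P p.n⊆P (finite⇒∈? Q q.fin) (finite⇒∈? P p.fin)
      where module p = FinitePrimeAbove p
            module q = FinitePrimeAbove q
    ... | inj₂ (x , x∈P , x∉Q) | _ =
      ⊈-comaximal {P} {Q} (FinitePrimeAbove.prime q) (FinitePrimeAbove.fin q) x∈P x∉Q
    ... | _ | inj₂ (x , x∈Q , x∉P) = comaximal-sym {Q} {P}
      (⊈-comaximal {Q} {P} (FinitePrimeAbove.prime p) (FinitePrimeAbove.fin p) x∈Q x∉P)
    ... | inj₁ P⊆Q | inj₁ Q⊆P = ⊥-elim (P≢Q ((λ x∈P → P⊆Q x∈P) , (λ x∈Q → Q⊆P x∈Q)))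

    pairwise-comaximal : ∀ {fs : List (Ideal O × ℕ)} → All (FinitePrimeAbove ∘ proj₁) fs →
      AllPairs (λ f g → ¬ (proj₁ f ≐ proj₁ g)) fs →
      AllPairs (λ f g → Comaximal (proj₁ f) (proj₁ g)) fs
    pairwise-comaximal [] [] = []
    pairwise-comaximal {(P , _) ∷ _} (p ∷ ps) (d ∷ ds) =
      row ps d ∷ pairwise-comaximal ps ds
      where
      row : ∀ {gs : List (Ideal O × ℕ)} → All (FinitePrimeAbove ∘ proj₁) gs →
            All (λ g → ¬ (P ≐ proj₁ g)) gs → All (λ g → Comaximal P (proj₁ g)) gs
      row [] [] = []
      row {(Q , _) ∷ _} (q ∷ qs) (P≢Q ∷ P≢Qs) = distinct⇒comaximal {P} {Q} p q P≢Q ∷ row qs P≢Qs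

    -- Shows that the quotient by a composite ideal is not a field. If `z` inverts `x`, then y = (x
    -- y) z vanishes modulo `n`.
    field⇒prime : IsProper n → IsField (quotient n) → IsPrime n
    field⇒prime 1∉n isField = record { proper = 1∉n ; split = split′ }
      where
      module Q = Quotient n
      open SetoidReasoning Q.setoid
      split′ : ∀ x y → (x * y) ∈ n → x ∈ n ⊎ y ∈ n
      split′ x y xy∈n with finite⇒∈? n finₙ x
      ... | yes x∈n = inj₁ x∈n
      ... | no  x∉n with z , xz~1 ← IsField.inverse isField x (x∉n ∘ ~0⇒∈ n) =
        inj₂ (~0⇒∈ n (begin
          y             ≈⟨ Q.*-identityʳ y ⟨
          y * 1#        ≈⟨ Q.*-congˡ {y} xz~1 ⟨
          y * (x * z)   ≈⟨ Q.*-assoc y x z ⟨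
          y * x * z     ≈⟨ Q.*-congʳ {z} (Q.*-comm y x) ⟩
          x * y * z     ≈⟨ Q.*-congʳ {z} (∈⇒~0 n xy∈n) ⟩
          0# * z        ≈⟨ Q.zeroˡ z ⟩
          0#            ∎))

    carmichael : IsComposite n → IsSquareFree n →
      (∀ (p : Ideal O) → IsPrime p → p ∣ᴵ n →
         Σ (FiniteNorm p) λ finₚ → (norm p finₚ ∸ 1) ∣ (norm n finₙ ∸ 1)) →
      IsCarmichaelIdeal n
    carmichael composite (F , simple) norms = record
      { finite   = finₙ
      ; notField = notPrime ∘ field⇒prime 1∉n
      ; power    = λ a → ≡.subst (λ z → (z - a) ∈ n)
          (≡.sym (^-quotient n a (norm n finₙ))) (power′ a)
      }
      where
      open PrimeFactorisation F
      open IsComposite composite renaming (proper to 1∉n)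
      primesAbove : All (FinitePrimeAbove ∘ proj₁) factors
      primesAbove = All.zipWith (λ { {P , _} (P-prime , P∣) →
          let P∣n = ∣-respʳ-≐ {P} {n} {primePowers factors} factorise P∣
              finₚ , norm∣ = norms P P-prime P∣n
          in record { n⊆P = ∣⇒⊇ {P} {n} P∣n ; prime = P-prime ; fin = finₚ ; norm∣ = norm∣ } })
        (prime , factor∣primePowers simple)
      power′ : ∀ a → (a ^ norm n finₙ - a) ∈ n
      -- The element a^N - a lies in each prime factor, hence in their product by pairwise
      -- comaximality.
      power′ a = proj₂ factorise (⋂⊆primePowers simple (pairwise-comaximal primesAbove distinct)
        (All.map (λ { {P , _} p → let module p = FinitePrimeAbove p in
            ≡.subst (λ N → (a ^ N - a) ∈ P) (≡.sym (norm≡suc n finₙ))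
              (PrimeQuotient.norm-1∣⇒power P p.prime p.fin (norm n finₙ ∸ 1) p.norm∣ a) })
          primesAbove))

theorem3p1 : ∀ {c ℓ : Level} (O : CommutativeRing c ℓ) → IsDedekindDomain O →
    (n : Ideal O) → IsComposite n →
    IsCarmichaelIdeal n ⇔
    (IsSquareFree n ×
    Σ (FiniteNorm n) λ finₙ →
    ∀ (p : Ideal O) → IsPrime p → p ∣ᴵ n →
    Σ (FiniteNorm p) λ finₚ → (norm p finₚ ∸ 1) ∣ (norm n finₙ ∸ 1))
theorem3p1 O dedekind n composite = mk⇔
  (λ carmichael →
    let module F = IdealTheory.Forward O n (IsComposite.proper composite) carmichael
    in F.squareFree , IsCarmichaelRing.finite carmichael , F.norms)
  (λ (squareFree , finₙ , norms) →
    IdealTheory.Backward.carmichael O n finₙ composite squareFree norms)
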